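{- Let $n\ge 1$, let $G$ be a simple acyclic directed graph on the vertex set $[n]=\{1,\dots,n\}$, and let $\vec d=(d_1,\dots,d_n)\in\mathbb{Z}_{\ge 1}^n$. If one of the following holds: (1) the entries of $\vec d$ are pairwise coprime (and $G$ is arbitrary); (2) $G$ is a directed path of length $n-1$ (and $\vec d$ is arbitrary); (3) $G$ contains a directed path of length $n-1$ and $\vec d=(m,m,\dots,m)$ for some integer $m\ge 1$; then the matrix $A_{\vec d,G}$ has a cyclic cokernel.
   Context: For a simple acyclic directed graph $G$ on $[n]$ and $\vec d\in\mathbb{Z}_{\ge1}^n$, the directed graphical simplex is the $n\times n$ integer matrix $A_{\vec d,G}=\operatorname{diag}(d_1,\dots,d_n)+\sum_{(i,j)\in E(G)}E_{i,j}$, where $(i,j)$ denotes an edge directed from $i$ to $j$ and $E_{i,j}$ is the matrix whose only nonzero entry is a $1$ in row $i$, column $j$. A path in $G$ is a sequence of vertices $v_1\to v_2\to\dots\to v_k$ with $(v_i,v_{i+1})\in E(G)$ for $1\le i\le k-1$; its length is the number $k-1$ of edges. "$G$ is a directed path of length $n-1$" means that the edges of $G$ are exactly the $n-1$ edges of a path $v_1\to v_2\to\dots\to v_n$ visiting all vertices of $[n]$. The cokernel of $A_{\vec d,G}$ is the finite abelian group $\mathbb{Z}^n/A_{\vec d,G}\mathbb{Z}^n\cong \mathbb{Z}/\alpha_1\mathbb{Z}\oplus\dots\oplus\mathbb{Z}/\alpha_n\mathbb{Z}$, where $\operatorname{diag}(\alpha_1,\dots,\alpha_n)$ is the Smith normal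 form of $A_{\vec d,G}$. The trivial group counts as cyclic. -}

module Defs where

open import Level using (Level; 0ℓ; _⊔_)
open import Algebra.Bundles using (Group; AbelianGroup)
open import Algebra.Morphism.Structures using (IsGroupHomomorphism)
import Algebra.Construct.Pointwise as Pointwise
import Algebra.Definitions.RawMonoid as RawMonoidDefinitions
import Algebra.Properties.AbelianGroup as AbelianGroupProperties
import Algebra.Properties.CommutativeSemigroup as CommutativeSemigroupProperties
import Algebra.Properties.Semiring.Sum as SemiringSum
import Relation.Binary.Reasoning.Setoid as SetoidReasoning
open import Data.Bool.Base using (if_then_else_; _∧_)
open import Data.Fin.Base using (Fin; suc; inject₁)
open import Data.Fin.Properties using (_≟_)
open import Data.Integer.Base using (ℤ; +_; -[1+_]; 0ℤ; 1ℤ; -1ℤ; _+_; _*_; -_)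
import Data.Integer.Properties as ℤ
open import Data.Nat.Base using (ℕ; _∸_)
open import Data.Nat.Coprimality using (Coprime)
open import Data.Product.Base using (Σ-syntax; ∃-syntax; _×_; _,_)
open import Data.Vec.Functional using (Vector)
open import Relation.Binary.Construct.Closure.Transitive using (TransClosure)
open import Relation.Binary.Core using (Rel)
open import Relation.Binary.Definitions using (Decidable; Irreflexive)
open import Relation.Binary.PropositionalEquality
  using (_≡_; _≢_; refl; sym; trans; cong)
open import Relation.Nullary using (¬_; does)

open SemiringSum ℤ.+-*-semiring public
  using (sum; sum-syntax; sum-cong-≗; ∑-distrib-+; *-distribˡ-sum)

private
  variable
    a b ℓ₁ ℓ₂ : Level
    m n : ℕ

------------------------------------------------------------------------
-- Groups

module _ (G : Group a ℓ₁) where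
  open Group G
  open RawMonoidDefinitions rawMonoid renaming (_×_ to _×ℕ_) using ()

  power : Carrier → ℤ → Carrier
  power g (+ k)    = k ×ℕ g
  power g -[1+ k ] = (ℕ.suc k ×ℕ g) ⁻¹

  Cyclic : Set (a ⊔ ℓ₁)
  Cyclic = ∃[ g ] ∀ x → ∃[ k ] x ≈ power g k

-- The quotient of G by the image of f: the carrier and operations are
-- those of G, and x, y are identified when x - y lies in the image.

module _ (H : AbelianGroup b ℓ₂) (G : AbelianGroup a ℓ₁)
  (f : AbelianGroup.Carrier H → AbelianGroup.Carrier G)
  (f-hom : IsGroupHomomorphism (AbelianGroup.rawGroup H) (AbelianGroup.rawGroup G) f)
  where

  private
    module H = AbelianGroup H
    module F = IsGroupHomomorphism f-hom
  open AbelianGroup G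
    renaming (refl to ≈-refl; sym to ≈-sym; trans to ≈-trans)
  open AbelianGroupProperties G
  open CommutativeSemigroupProperties commutativeSemigroup using (interchange)
  open SetoidReasoning setoid

  infix 4 _∼_

  _∼_ : Rel Carrier (b ⊔ ℓ₁)
  x ∼ y = ∃[ w ] f w ≈ x - y

  private
    ≈⇒∼ : ∀ {x y} → x ≈ y → x ∼ y
    ≈⇒∼ x≈y = H.ε , ≈-trans F.ε-homo (≈-sym (x≈y⇒x∙y⁻¹≈ε x≈y))

    ∼-sym : ∀ {x y} → x ∼ y → y ∼ x
    ∼-sym {x} {y} (w , fw≈x-y) = w H.⁻¹ , (begin
      f (w H.⁻¹)  ≈⟨ F.⁻¹-homo w ⟩
      f w ⁻¹      ≈⟨ ⁻¹-cong fw≈x-y ⟩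
      (x - y) ⁻¹  ≈⟨ ⁻¹-anti-homo‿- x y ⟩
      y - x       ∎)

    ∼-trans : ∀ {x y z} → x ∼ y → y ∼ z → x ∼ z
    ∼-trans {x} {y} {z} (v , fv≈x-y) (w , fw≈y-z) = v H.∙ w , (begin
      f (v H.∙ w)        ≈⟨ F.homo v w ⟩
      f v ∙ f w          ≈⟨ ∙-cong fv≈x-y fw≈y-z ⟩
      (x - y) ∙ (y - z)  ≈⟨ assoc (x - y) y (z ⁻¹) ⟨
      (x - y) ∙ y - z    ≈⟨ ∙-congʳ (//-rightDividesˡ y x) ⟩
      x - z              ∎)

    ∼-∙-cong : ∀ {x y u v} → x ∼ y → u ∼ v → (x ∙ u) ∼ (y ∙ v)
    ∼-∙-cong {x} {y} {u} {v} (s , fs≈x-y) (t , ft≈u-v) = s H.∙ t , (begin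
      f (s H.∙ t)              ≈⟨ F.homo s t ⟩
      f s ∙ f t                ≈⟨ ∙-cong fs≈x-y ft≈u-v ⟩
      (x - y) ∙ (u - v)        ≈⟨ interchange x (y ⁻¹) u (v ⁻¹) ⟩
      (x ∙ u) ∙ (y ⁻¹ ∙ v ⁻¹)  ≈⟨ ∙-congˡ (⁻¹-∙-comm y v) ⟩
      (x ∙ u) - (y ∙ v)        ∎)

    ∼-⁻¹-cong : ∀ {x y} → x ∼ y → (x ⁻¹) ∼ (y ⁻¹)
    ∼-⁻¹-cong {x} {y} (w , fw≈x-y) = w H.⁻¹ , (begin
      f (w H.⁻¹)     ≈⟨ F.⁻¹-homo w ⟩
      f w ⁻¹         ≈⟨ ⁻¹-cong fw≈x-y ⟩
      (x - y) ⁻¹     ≈⟨ ⁻¹-∙-comm x (y ⁻¹) ⟨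
      x ⁻¹ - y ⁻¹    ∎)

  cokernel : AbelianGroup a (b ⊔ ℓ₁)
  cokernel = record
    { Carrier        = Carrier
    ; _≈_            = _∼_
    ; _∙_            = _∙_
    ; ε              = ε
    ; _⁻¹            = _⁻¹
    ; isAbelianGroup = record
      { isGroup = record
        { isMonoid = record
          { isSemigroup = record
            { isMagma = record
              { isEquivalence = record
                { refl  = ≈⇒∼ ≈-refl
                ; sym   = ∼-sym
                ; trans = ∼-trans
                }
              ; ∙-cong = ∼-∙-cong
              }
            ; assoc = λ x y z → ≈⇒∼ (assoc x y z)
            }
          ; identity = (λ x → ≈⇒∼ (identityˡ x)) , (λ x → ≈⇒∼ (identityʳ x))
          }
        ; inverse = (λ x → ≈⇒∼ (inverseˡ x)) , (λ x → ≈⇒∼ (inverseʳ x))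
        ; ⁻¹-cong = ∼-⁻¹-cong
        }
      ; comm = λ x y → ≈⇒∼ (comm x y)
      }
    }

------------------------------------------------------------------------
-- Integer matrices

ℤ^ : ℕ → AbelianGroup 0ℓ 0ℓ
ℤ^ n = Pointwise.abelianGroup (Fin n) ℤ.+-0-abelianGroup

Matrix : ℕ → ℕ → Set
Matrix m n = Fin m → Fin n → ℤ

infixr 8 _·_

_·_ : Matrix m n → Vector ℤ n → Vector ℤ m
_·_ {n = n} A w i = ∑[ j < n ] (A i j * w j)

·-isGroupHomomorphism : (A : Matrix m n) →
  IsGroupHomomorphism (AbelianGroup.rawGroup (ℤ^ n)) (AbelianGroup.rawGroup (ℤ^ m)) (A ·_)
·-isGroupHomomorphism {m} {n} A = record
  { isMonoidHomomorphism = record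
    { isMagmaHomomorphism = record
      { isRelHomomorphism = record
        { cong = λ v≗w i → sum-cong-≗ (λ j → cong (A i j *_) (v≗w j)) }
      ; homo = λ v w i → trans
          (sum-cong-≗ (λ j → ℤ.*-distribˡ-+ (A i j) (v j) (w j)))
          (∑-distrib-+ (λ j → A i j * v j) (λ j → A i j * w j))
      }
    ; ε-homo = λ i → scale i 0ℤ (λ _ → 0ℤ) (λ _ → 0ℤ) (λ _ → refl)
    }
  ; ⁻¹-homo = λ w i → trans
      (scale i -1ℤ (λ j → - w j) w (λ j → sym (ℤ.-1*i≡-i (w j))))
      (ℤ.-1*i≡-i ((A · w) i))
  }
  where
  open CommutativeSemigroupProperties ℤ.*-commutativeSemigroup using (x∙yz≈y∙xz)

  scale : ∀ i c (v w : Vector ℤ n) → (∀ j → v j ≡ c * w j) →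
          (A · v) i ≡ c * (A · w) i
  scale i c v w v≗cw = trans
    (sum-cong-≗ (λ j → trans (cong (A i j *_) (v≗cw j)) (x∙yz≈y∙xz (A i j) c (w j))))
    (sym (*-distribˡ-sum c (λ j → A i j * w j)))

coker : Matrix m n → AbelianGroup 0ℓ 0ℓ
coker {m} {n} A = cokernel (ℤ^ n) (ℤ^ m) (A ·_) (·-isGroupHomomorphism A)

diag : Vector ℤ n → Matrix n n
diag d i j = if does (i ≟ j) then d i else 0ℤ

E : Fin m → Fin n → Matrix m n
E k l i j = if does (i ≟ k) ∧ does (j ≟ l) then 1ℤ else 0ℤ

------------------------------------------------------------------------
-- Directed graphs on Fin n

-- Edges form a relation and only its truth value is ever used, so there
-- are no parallel edges.

record SimpleDigraph (n : ℕ) : Set₁ where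
  field
    Edge   : Rel (Fin n) 0ℓ
    edge?  : Decidable Edge
    noLoop : Irreflexive _≡_ Edge

open SimpleDigraph public

Acyclic : SimpleDigraph n → Set
Acyclic G = ∀ v → ¬ TransClosure (Edge G) v v

-- A path of length ℓ has ℓ edges, hence suc ℓ vertices.

record Path {n : ℕ} (G : SimpleDigraph n) (ℓ : ℕ) : Set where
  field
    vertex : Vector (Fin n) (ℕ.suc ℓ)
    step   : ∀ (k : Fin ℓ) → Edge G (vertex (inject₁ k)) (vertex (suc k))

open Path public

-- The edges of G are exactly those of a path of length n - 1 through all
-- vertices (that the steps of the path are edges of G is part of Path).

IsDirectedPath : SimpleDigraph n → Set
IsDirectedPath {n} G = Σ[ p ∈ Path G (n ∸ 1) ]
  (∀ v → ∃[ k ] vertex p k ≡ v) ×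
  (∀ i j → Edge G i j → ∃[ k ] (i ≡ vertex p (inject₁ k) × j ≡ vertex p (suc k)))

------------------------------------------------------------------------
-- Directed graphical simplices

directedGraphicalSimplex : Vector ℕ n → SimpleDigraph n → Matrix n n
directedGraphicalSimplex {n} d G i j =
  diag (λ k → + d k) i j +
  ∑[ k < n ] ∑[ l < n ] (if does (edge? G k l) then E k l i j else 0ℤ)

PairwiseCoprime : Vector ℕ n → Set
PairwiseCoprime d = ∀ i j → i ≢ j → Coprime (d i) (d j)

{-# OPTIONS --safe #-}
-- Write e_v for the classes of the standard basis vectors in the cokernel;
-- column v of the matrix gives the relation d_v e_v + Σ_{u → v} e_u = 0.
--
-- (1) Adjoin the e_v in an order in which in-neighbours come first.  If the
-- e_u adjoined so far lie in ⟨g⟩ and P g = 0 for P the product of their d_u,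
-- then d_v e_v ∈ ⟨g⟩ with d_v coprime to P, so ⟨g, e_v⟩ is again cyclic.
--
-- (2) Along the path the relation reads e_{v_k} = - d_{v_{k+1}} e_{v_{k+1}},
-- so the last vertex generates.
--
-- (3) The path is a topological order, so the adjacency matrix N is strictly
-- upper triangular along it with ones above the diagonal.  Hence the vectors
-- N^k e_{v_n} form a basis of ℤⁿ; as N acts on the cokernel as -m, they are
-- all multiples of the last basis vector.

module Submission where

open import Defs
open import Algebra.Bundles using (AbelianGroup)
open import Data.Bool.Base using (true; false; if_then_else_; _∧_)
open import Data.Fin.Base using (Fin; zero; suc; inject₁; fromℕ; toℕ; punchOut)
  renaming (_<_ to _<ᶠ_)
open import Data.Fin.Induction
  using (<-weakInduction; >-weakInduction; spo-wellFounded)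
open import Data.Fin.Properties
  using (_≟_; any?; <-cmp; toℕ-inject₁; toℕ-injective; toℕ<n; toℕ-fromℕ;
         injective⇒≤; punchOut-injective; punchInᵢ≢i)
open import Data.Fin.Subset using (Subset; _⊃_; _∈_; _∉_; _∪_; ⁅_⁆; ⊥)
open import Data.Fin.Subset.Induction using (⊃-wellFounded)
open import Data.Fin.Subset.Properties
  using (_∈?_; ∉⊥; x∈⁅x⁆; x∈⁅y⁆⇒x≡y; x∈p∪q⁻; x∈p∪q⁺; p⊆p∪q)
open import Data.Integer.Base using (ℤ; +_; -[1+_]; 0ℤ; 1ℤ; _+_; _*_; -_)
import Data.Integer.Properties as ℤ
open import Data.Integer.Solver using (module +-*-Solver)
open import Data.Nat.Base as ℕ using (ℕ; _≤_; _∸_)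
open import Data.Nat.Coprimality
  using (Coprime; coprime-Bézout; coprime-factors; 1-coprimeTo)
  renaming (sym to coprime-sym)
open import Data.Nat.Divisibility using (∣-trans; m∣m*n)
open import Data.Nat.GCD using (module Bézout)
import Data.Nat.Properties as ℕ
open import Data.Product.Base using (∃-syntax; _×_; _,_; proj₁; proj₂)
open import Data.Sum.Base using (_⊎_; inj₁; inj₂)
open import Data.Vec.Functional using (Vector; removeAt)
open import Function.Base using (_∘_)
open import Function.Definitions using (Injective)
open import Induction.WellFounded using (Acc; acc; WellFounded)
open import Relation.Binary.Construct.Closure.Transitive
  using (TransClosure; [_]; _∷ʳ_; _++_)
open import Relation.Binary.Definitions using (tri<; tri≈; tri>)
open import Relation.Binary.PropositionalEquality
  using (_≡_; _≢_; _≗_; refl; sym; trans; cong; cong₂; subst; isEquivalence; module ≡-Reasoning)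
open import Relation.Nullary using (¬_; yes; no; does; contradiction)
open import Relation.Nullary.Decidable using (¬?; _×-dec_; dec-true; dec-false; decidable-stable)
import Algebra.Properties.Semiring.Sum as SemiringSum

open SemiringSum ℤ.+-*-semiring using (sum-remove; sum-replicate-zero)
open +-*-Solver using (solve; _:+_; _:*_; :-_; _:=_; con)

private
  variable
    m n : ℕ

-- Finite sums, coprimality and a pigeonhole argument.

sum-zero : {f : Vector ℤ n} → (∀ k → f k ≡ 0ℤ) → sum f ≡ 0ℤ
sum-zero {n} f≗0 = trans (sum-cong-≗ f≗0) (sum-replicate-zero n)

sum-single : (f : Vector ℤ n) (i : Fin n) → (∀ k → k ≢ i → f k ≡ 0ℤ) → sum f ≡ f i
sum-single {ℕ.suc n} f i f≡0 = begin
  sum f                     ≡⟨ sum-remove {i = i} f ⟩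
  f i + sum (removeAt f i)  ≡⟨ cong (_+_ (f i)) (sum-zero (λ k → f≡0 _ (punchInᵢ≢i i k))) ⟩
  f i + 0ℤ                  ≡⟨ ℤ.+-identityʳ (f i) ⟩
  f i                       ∎
  where open ≡-Reasoning

bézout-to-ℤ : ∀ x a y b → 1 ℕ.+ y ℕ.* b ≡ x ℕ.* a → 1ℤ + + y * + b ≡ + x * + a
bézout-to-ℤ x a y b eq =
  trans (cong (_+_ 1ℤ) (sym (ℤ.pos-* y b))) (trans (cong +_ eq) (ℤ.pos-* x a))

-- Over ℕ there are two cases, according to which product exceeds the other by one; signed
-- coefficients merge them.
coprime⇒bézout : ∀ {a b} → Coprime a b → ∃[ u ] ∃[ v ] u * + a + v * + b ≡ 1ℤ
coprime⇒bézout {a} {b} a⊥b with coprime-Bézout a⊥b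
... | Bézout.+- x y eq = + x , - + y , trans
  (cong (_+ - + y * + b) (sym (bézout-to-ℤ x a y b eq)))
  (solve 2 (λ p q → con 1ℤ :+ p :* q :+ (:- p) :* q := con 1ℤ) refl (+ y) (+ b))
... | Bézout.-+ x y eq = - + x , + y , trans
  (cong (_+_ (- + x * + a)) (sym (bézout-to-ℤ y b x a eq)))
  (solve 2 (λ p q → (:- p) :* q :+ (con 1ℤ :+ p :* q) := con 1ℤ) refl (+ x) (+ a))

-- A common divisor of `a` and `b * c` divides both `a * c` and `b * c`, hence `c` because `a` and
-- `b` are coprime.
coprime-* : ∀ {a b c} → Coprime a b → Coprime a c → Coprime a (b ℕ.* c)
coprime-* {c = c} a⊥b a⊥c (k∣a , k∣bc) =
  a⊥c (k∣a , coprime-factors a⊥b (∣-trans k∣a (m∣m*n c) , k∣bc))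

-- If `y` were missed, deleting it from the codomain would inject a set of `suc n` elements into one
-- of `n`.
injective⇒surjective : {f : Fin n → Fin n} → Injective _≡_ _≡_ f → ∀ y → ∃[ x ] f x ≡ y
injective⇒surjective {ℕ.suc n} {f} inj y with any? (λ x → f x ≟ y)
... | yes hit = hit
... | no miss = contradiction
  (injective⇒≤ {f = λ x → punchOut (y≢f x)} (λ {k} {l} → inj ∘ punchOut-injective (y≢f k) (y≢f l)))
  ℕ.1+n≰n
  where
  y≢f : ∀ x → y ≢ f x
  y≢f x y≡fx = miss (x , sym y≡fx)

-- Standard basis vectors and the action of matrices.

basis : Fin n → Vector ℤ n
basis j i = diag (λ _ → 1ℤ) i j

diag-≡ : (d : Vector ℤ n) (i : Fin n) → diag d i i ≡ d i
diag-≡ d i = cong (if_then d i else 0ℤ) (dec-true (i ≟ i) refl)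

diag-≢ : (d : Vector ℤ n) {i j : Fin n} → i ≢ j → diag d i j ≡ 0ℤ
diag-≢ d {i} {j} i≢j = cong (if_then d i else 0ℤ) (dec-false (i ≟ j) i≢j)

diag-· : (d w : Vector ℤ n) (i : Fin n) → (diag d · w) i ≡ d i * w i
diag-· d w i = trans
  (sum-single _ i (λ k k≢i → trans (cong (_* w k) (diag-≢ d (k≢i ∘ sym))) (ℤ.*-zeroˡ (w k))))
  (cong (_* w i) (diag-≡ d i))

·-basis : (A : Matrix m n) (j : Fin n) (i : Fin m) → (A · basis j) i ≡ A i j
·-basis A j i = trans
  (sum-single _ j (λ k k≢j → trans (cong (A i k *_) (diag-≢ _ k≢j)) (ℤ.*-zeroʳ (A i k))))
  (trans (cong (A i j *_) (diag-≡ _ j)) (ℤ.*-identityʳ (A i j)))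

·-linear : (A : Matrix m n) (a b : ℤ) (v w : Vector ℤ n) (i : Fin m) →
  (A · (λ j → a * v j + b * w j)) i ≡ a * (A · v) i + b * (A · w) i
·-linear {n = n} A a b v w i = begin
  sum (λ j → A i j * (a * v j + b * w j))
    ≡⟨ sum-cong-≗ (λ j → solve 5
         (λ x a b v w → x :* (a :* v :+ b :* w) := a :* (x :* v) :+ b :* (x :* w))
         refl (A i j) a b (v j) (w j)) ⟩
  sum (λ j → a * (A i j * v j) + b * (A i j * w j))
    ≡⟨ ∑-distrib-+ (λ j → a * (A i j * v j)) (λ j → b * (A i j * w j)) ⟩
  sum (λ j → a * (A i j * v j)) + sum (λ j → b * (A i j * w j))
    ≡⟨ cong₂ _+_ (*-distribˡ-sum a (λ j → A i j * v j)) (*-distribˡ-sum b (λ j → A i j * w j)) ⟨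
  a * (A · v) i + b * (A · w) i  ∎
  where open ≡-Reasoning

-- Cyclic subgroups of a cokernel

module Coker (A : Matrix m n) where

  -- Vanishing in the cokernel, witnessed by a preimage under `A`.
  record Null (x : Vector ℤ m) : Set where
    constructor null
    field
      preimage : Vector ℤ n
      image    : A · preimage ≗ x

  infix 4 _∈⟨_⟩

  -- Membership in a cyclic subgroup of the cokernel, with an integer coefficient in place of
  -- `power`, so that closure properties reduce to polynomial identities. `power≗*` translates back
  -- at the end.
  record _∈⟨_⟩ (x g : Vector ℤ m) : Set where
    constructor member
    field
      coefficient : ℤ
      remainder   : Null (λ i → x i + - (coefficient * g i))

  null-linear : ∀ {x y z} a b → Null x → Null y →
    (∀ i → z i ≡ a * x i + b * y i) → Null z
  null-linear a b (null v Av≗x) (null w Aw≗y) z≗ = null (λ j → a * v j + b * w j) λ i → trans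
    (trans (·-linear A a b v w i) (cong₂ _+_ (cong (a *_) (Av≗x i)) (cong (b *_) (Aw≗y i))))
    (sym (z≗ i))

  null-image : ∀ w → Null (A · w)
  null-image w = null w λ _ → refl

  null-zero : ∀ {x} → (∀ i → x i ≡ 0ℤ) → Null x
  null-zero x≗0 = null (λ _ → 0ℤ)
    λ i → trans (sum-zero (λ j → ℤ.*-zeroʳ (A i j))) (sym (x≗0 i))

  ∈-linear : ∀ {x y z g} a b → x ∈⟨ g ⟩ → y ∈⟨ g ⟩ →
    (∀ i → z i ≡ a * x i + b * y i) → z ∈⟨ g ⟩
  ∈-linear {x} {y} {z} {g} a b (member k X) (member l Y) z≗ =
    member (a * k + b * l) (null-linear a b X Y λ i →
    trans (cong (_+ - ((a * k + b * l) * g i)) (z≗ i))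
      (solve 7 (λ a b k l x y g →
          a :* x :+ b :* y :+ (:- ((a :* k :+ b :* l) :* g)) :=
          a :* (x :+ (:- (k :* g))) :+ b :* (y :+ (:- (l :* g))))
        refl a b k l (x i) (y i) (g i)))

  ∈-null : ∀ {x g} → Null x → x ∈⟨ g ⟩
  ∈-null {x} {g} (null w Aw≗x) = member 0ℤ (null w λ i → trans (Aw≗x i)
    (solve 2 (λ x g → x := x :+ (:- (con 0ℤ :* g))) refl (x i) (g i)))

  ∈-refl : ∀ {g} → g ∈⟨ g ⟩
  ∈-refl {g} = member 1ℤ (null-zero λ i →
    solve 1 (λ g → g :+ (:- (con 1ℤ :* g)) := con 0ℤ) refl (g i))

  ∈-trans : ∀ {x g h} → x ∈⟨ g ⟩ → g ∈⟨ h ⟩ → x ∈⟨ h ⟩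
  ∈-trans {x} {g} (member k X) g∈h = ∈-linear 1ℤ k (∈-null X) g∈h λ i →
    solve 3 (λ x k g → x := con 1ℤ :* (x :+ (:- (k :* g))) :+ k :* g) refl (x i) k (g i)

  ∈-scale : ∀ {x y g} a → x ∈⟨ g ⟩ → (∀ i → y i ≡ a * x i) → y ∈⟨ g ⟩
  ∈-scale {x} {y} a x∈g y≗ = ∈-linear a 0ℤ x∈g x∈g λ i → trans (y≗ i)
    (solve 2 (λ a x → a :* x := a :* x :+ con 0ℤ :* x) refl a (x i))

  ∈-sum : ∀ {k g} (f : Fin k → Vector ℤ m) → (∀ j → f j ∈⟨ g ⟩) →
    (λ i → ∑[ j < k ] f j i) ∈⟨ g ⟩
  ∈-sum {ℕ.zero}  f f∈g = ∈-null (null-zero (λ _ → refl))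
  ∈-sum {ℕ.suc k} f f∈g = ∈-linear 1ℤ 1ℤ (f∈g zero) (∈-sum (f ∘ suc) (f∈g ∘ suc)) λ i →
    sym (cong₂ _+_ (ℤ.*-identityˡ (f zero i)) (ℤ.*-identityˡ (∑[ j < k ] f (suc j) i)))

  -- The expansion of `x` in the standard basis is the identity matrix applied to `x`, which
  -- `diag-·` evaluates.
  basis∈⇒all∈ : ∀ {g} → (∀ j → basis j ∈⟨ g ⟩) → ∀ x → x ∈⟨ g ⟩
  basis∈⇒all∈ b∈g x = ∈-scale 1ℤ
    (∈-sum (λ j i → basis j i * x j) λ j → ∈-scale (x j) (b∈g j) λ i → ℤ.*-comm (basis j i) (x j))
    λ i → sym (trans (ℤ.*-identityˡ _) (trans (diag-· _ x i) (ℤ.*-identityˡ (x i))))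

  -- With uP + vb = 1 and by = tg, the element y - vtg is killed by b while
  -- g is killed by P, so their sum generates both.
  coprime-extension : ∀ {g y} b P → Null (λ i → + P * g i) →
    (λ i → + b * y i) ∈⟨ g ⟩ → Coprime P b →
    ∃[ g′ ] g ∈⟨ g′ ⟩ × y ∈⟨ g′ ⟩ × Null (λ i → + (P ℕ.* b) * g′ i)
  coprime-extension {g} {y} b P Pg (member t by-tg) P⊥b with coprime⇒bézout P⊥b
  ... | u , v , eq = g′ , g∈ , y∈ , Pbg′
    where
    c = 1ℤ + - (v * t)
    g′ : Vector ℤ m
    g′ i = y i + c * g i

    uP≡1-vb : u * + P ≡ 1ℤ + - (v * + b)
    uP≡1-vb = trans
      (solve 2 (λ p q → p := p :+ q :+ (:- q)) refl (u * + P) (v * + b))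
      (cong (_+ - (v * + b)) eq)

    g∈ : g ∈⟨ g′ ⟩
    -- In the cokernel, vb g′ = vt g + c(1 - uP) g = vt g + c g = g, using by = tg and Pg = 0.
    g∈ = member (v * + b) (null-linear (- v) (u * c) by-tg Pg λ i → begin
      g i + - (v * + b * g′ i)
        ≡⟨ solve 5 (λ v b t g y →
             g :+ (:- (v :* b :* (y :+ (con 1ℤ :+ (:- (v :* t))) :* g))) :=
             (:- v) :* (b :* y :+ (:- (t :* g))) :+
             (con 1ℤ :+ (:- (v :* t))) :* ((con 1ℤ :+ (:- (v :* b))) :* g))
             refl v (+ b) t (g i) (y i) ⟩
      - v * (+ b * y i + - (t * g i)) + c * ((1ℤ + - (v * + b)) * g i)
        ≡⟨ cong (λ z → - v * (+ b * y i + - (t * g i)) + c * (z * g i)) uP≡1-vb ⟨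
      - v * (+ b * y i + - (t * g i)) + c * (u * + P * g i)
        ≡⟨ cong (_+_ (- v * (+ b * y i + - (t * g i))))
             (solve 4 (λ c u P g → c :* (u :* P :* g) := u :* c :* (P :* g)) refl c u (+ P) (g i)) ⟩
      - v * (+ b * y i + - (t * g i)) + u * c * (+ P * g i) ∎)
      where open ≡-Reasoning

    y∈ : y ∈⟨ g′ ⟩
    y∈ = ∈-linear 1ℤ (- c) ∈-refl g∈ λ i →
      solve 3 (λ y c g → y := con 1ℤ :* (y :+ c :* g) :+ (:- c) :* g) refl (y i) c (g i)

    Pbg′ : Null (λ i → + (P ℕ.* b) * g′ i)
    Pbg′ = null-linear (+ P) (t + c * + b) by-tg Pg λ i →
      trans (cong (_* g′ i) (ℤ.pos-* P b))
        (solve 6 (λ P b y c g t →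
            P :* b :* (y :+ c :* g) :=
            P :* (b :* y :+ (:- (t :* g))) :+ (t :+ c :* b) :* (P :* g))
          refl (+ P) (+ b) (y i) c (g i) t)

  private
    multiple : ∀ k (g : Vector ℤ m) i → power (AbelianGroup.group (coker A)) g (+ k) i ≡ + k * g i
    multiple ℕ.zero    g i = sym (ℤ.*-zeroˡ (g i))
    multiple (ℕ.suc k) g i = trans (cong (_+_ (g i)) (multiple k g i)) (sym (ℤ.suc-* (+ k) (g i)))

  power≗* : ∀ k (g : Vector ℤ m) → power (AbelianGroup.group (coker A)) g k ≗ λ i → k * g i
  power≗* (+ k)    g i = multiple k g i
  power≗* -[1+ k ] g i = trans (cong -_ (multiple (ℕ.suc k) g i)) (ℤ.neg-distribˡ-* (+ ℕ.suc k) (g i))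

  generator⇒cyclic : ∀ g → (∀ x → x ∈⟨ g ⟩) → Cyclic (AbelianGroup.group (coker A))
  generator⇒cyclic g all = g , λ x → let member k (null w Aw≗) = all x in
    k , w , λ i → trans (Aw≗ i) (cong (λ z → x i + - z) (sym (power≗* k g i)))

-- Paths in acyclic graphs

-- Induction on the later index. Under acyclicity this excludes repeated vertices and backward
-- edges.
path-< : {G : SimpleDigraph n} (p : Path G m) → ∀ l k → k <ᶠ l →
  TransClosure (Edge G) (vertex p k) (vertex p l)
path-< {G = G} p = <-weakInduction _ (λ _ ()) ind
  where
  ind : ∀ i → (∀ k → k <ᶠ inject₁ i → TransClosure (Edge G) (vertex p k) (vertex p (inject₁ i))) →
        ∀ k → k <ᶠ suc i → TransClosure (Edge G) (vertex p k) (vertex p (suc i))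
  ind i ih k (ℕ.s≤s k≤i) with ℕ.m≤n⇒m<n∨m≡n k≤i
  ... | inj₁ k<i = ih k (subst (toℕ k ℕ.<_) (sym (toℕ-inject₁ i)) k<i) ∷ʳ step p i
  ... | inj₂ k≡i with refl ← toℕ-injective (trans k≡i (sym (toℕ-inject₁ i))) = [ step p i ]

module _ {G : SimpleDigraph n} (acyclic : Acyclic G) where

  path-injective : (p : Path G m) → Injective _≡_ _≡_ (vertex p)
  path-injective p {k} {l} eq with <-cmp k l
  ... | tri< k<l _ _ = contradiction
    (subst (λ v → TransClosure (Edge G) v (vertex p l)) eq (path-< p l k k<l)) (acyclic _)
  ... | tri≈ _ k≡l _ = k≡l
  ... | tri> _ _ l<k = contradiction
    (subst (TransClosure (Edge G) (vertex p l)) eq (path-< p k l l<k)) (acyclic _)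

  -- A backward edge would close a segment of the path into a cycle, so the path orders its vertices
  -- topologically.
  path-edge-< : (p : Path G m) → ∀ {k l} → Edge G (vertex p k) (vertex p l) → k <ᶠ l
  path-edge-< p {k} {l} e with <-cmp k l
  ... | tri< k<l _ _ = k<l
  ... | tri≈ _ refl _ = contradiction [ e ] (acyclic _)
  ... | tri> _ _ l<k = contradiction (path-< p k l l<k ∷ʳ e) (acyclic _)

  -- Acyclicity makes reachability a strict partial order, and such an order on a finite set is well
  -- founded.
  ancestor-wellFounded : WellFounded (TransClosure (Edge G))
  ancestor-wellFounded = spo-wellFounded {_≈_ = _≡_} record
    { isEquivalence = isEquivalence
    ; irrefl        = λ { refl → acyclic _ }
    ; trans         = _++_
    ; <-resp-≈      = (λ { refl r → r }) , (λ { refl r → r })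
    }

  -- Step back to an in-neighbour outside `S` while there is one; well-foundedness ends the walk.
  -- This yields a topological order one vertex at a time.
  minimal-outside : (S : Subset n) → ∀ {v} → v ∉ S →
    ∃[ u ] u ∉ S × (∀ w → Edge G w u → w ∈ S)
  minimal-outside S {v} = go (ancestor-wellFounded v)
    where
    go : ∀ {v} → Acc (TransClosure (Edge G)) v → v ∉ S →
         ∃[ u ] u ∉ S × (∀ w → Edge G w u → w ∈ S)
    go {v} (acc rs) v∉S with any? (λ w → edge? G w v ×-dec ¬? (w ∈? S))
    ... | yes (w , e , w∉S) = go (rs [ e ]) w∉S
    ... | no none = v , v∉S , λ w e → decidable-stable (w ∈? S) (λ w∉S → none (w , e , w∉S))

-- Directed graphical simplices

adjacency : SimpleDigraph n → Matrix n n
adjacency G i j = if does (edge? G i j) then 1ℤ else 0ℤ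

module _ (G : SimpleDigraph n) where

  adjacency-edge : ∀ {i j} → Edge G i j → adjacency G i j ≡ 1ℤ
  adjacency-edge {i} {j} e = cong (if_then 1ℤ else 0ℤ) (dec-true (edge? G i j) e)

  adjacency-nonedge : ∀ {i j} → ¬ Edge G i j → adjacency G i j ≡ 0ℤ
  adjacency-nonedge {i} {j} ¬e = cong (if_then 1ℤ else 0ℤ) (dec-false (edge? G i j) ¬e)

  -- Only the summand with k = i and l = j can be nonzero at this entry.
  edge-matrix-sum : ∀ i j →
    ∑[ k < n ] ∑[ l < n ] (if does (edge? G k l) then E k l i j else 0ℤ) ≡ adjacency G i j
  edge-matrix-sum i j = trans
    (sum-single _ i λ k k≢i → sum-zero λ l → off (does (edge? G k l)) (E-row (k≢i ∘ sym)))
    (trans (sum-single _ j λ l l≢j → off (does (edge? G i l)) (E-column (l≢j ∘ sym)))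
      (cong (if does (edge? G i j) then_else 0ℤ) E-diag))
    where
    off : ∀ b {z} → z ≡ 0ℤ → (if b then z else 0ℤ) ≡ 0ℤ
    off true  z≡0 = z≡0
    off false _   = refl

    E-row : ∀ {k l} → i ≢ k → E k l i j ≡ 0ℤ
    E-row {k} {l} i≢k = cong (λ b → if b ∧ does (j ≟ l) then 1ℤ else 0ℤ) (dec-false (i ≟ k) i≢k)

    E-column : ∀ {l} → j ≢ l → E i l i j ≡ 0ℤ
    E-column {l} j≢l = cong₂ (λ b c → if b ∧ c then 1ℤ else 0ℤ)
      (dec-true (i ≟ i) refl) (dec-false (j ≟ l) j≢l)

    E-diag : E i j i j ≡ 1ℤ
    E-diag = cong₂ (λ b c → if b ∧ c then 1ℤ else 0ℤ) (dec-true (i ≟ i) refl) (dec-true (j ≟ j) refl)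

  module _ (d : Vector ℕ n) where

    simplex-· : ∀ w i →
      (directedGraphicalSimplex d G · w) i ≡ + d i * w i + (adjacency G · w) i
    simplex-· w i = begin
      sum (λ j → directedGraphicalSimplex d G i j * w j)
        ≡⟨ sum-cong-≗ (λ j → trans
             (cong (λ z → (diag (λ k → + d k) i j + z) * w j) (edge-matrix-sum i j))
             (ℤ.*-distribʳ-+ (w j) (diag (λ k → + d k) i j) (adjacency G i j))) ⟩
      sum (λ j → diag (λ k → + d k) i j * w j + adjacency G i j * w j)
        ≡⟨ ∑-distrib-+ (λ j → diag (λ k → + d k) i j * w j) (λ j → adjacency G i j * w j) ⟩
      (diag (λ k → + d k) · w) i + (adjacency G · w) i
        ≡⟨ cong (_+ (adjacency G · w) i) (diag-· (λ k → + d k) w i) ⟩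
      + d i * w i + (adjacency G · w) i ∎
      where open ≡-Reasoning

    simplex-basis : ∀ v i →
      (directedGraphicalSimplex d G · basis v) i ≡ + d v * basis v i + adjacency G i v
    simplex-basis v i = trans (simplex-· (basis v) i) (cong₂ _+_ local (·-basis (adjacency G) v i))
      where
      -- `basis v` vanishes off `v`, so `d i` may be replaced by `d v`.
      local : + d i * basis v i ≡ + d v * basis v i
      local with i ≟ v
      ... | yes refl = refl
      ... | no  _    = trans (ℤ.*-zeroʳ (+ d i)) (sym (ℤ.*-zeroʳ (+ d v)))

-- Pairwise coprime diagonal entries.

module Simplex (G : SimpleDigraph n) (acyclic : Acyclic G) (d : Vector ℕ n) where

  open Coker (directedGraphicalSimplex d G)

  module _ (d-coprime : PairwiseCoprime d) where

    -- The invariant of the construction. `order` need only annihilate the generator; its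
    -- coprimality to the entries outside `S` is what lets `coprime-extension` adjoin another
    -- vertex.
    record Generates (S : Subset n) : Set where
      field
        generator : Vector ℤ n
        order     : ℕ
        spans     : ∀ v → v ∈ S → basis v ∈⟨ generator ⟩
        torsion   : Null (λ i → + order * generator i)
        coprime   : ∀ v → v ∉ S → Coprime (d v) order

    open Generates

    generates-⊥ : Generates ⊥
    generates-⊥ = record
      { generator = λ _ → 0ℤ
      ; order     = 1
      ; spans     = λ v v∈⊥ → contradiction v∈⊥ ∉⊥
      ; torsion   = null-zero (λ _ → refl)
      ; coprime   = λ v _ → coprime-sym (1-coprimeTo (d v))
      }

    -- Column `v` of the adjacency matrix is the sum of the basis vectors of the in-neighbours of
    -- `v`, all of which are already spanned.
    in-neighbours∈ : ∀ {S} (γ : Generates S) {v} → (∀ u → Edge G u v → u ∈ S) →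
      (λ i → adjacency G i v) ∈⟨ generator γ ⟩
    in-neighbours∈ γ {v} preds = ∈-scale 1ℤ
      (∈-sum (λ u i → basis u i * adjacency G u v) term)
      λ i → sym (trans (ℤ.*-identityˡ _)
        (trans (diag-· _ (λ u → adjacency G u v) i) (ℤ.*-identityˡ _)))
      where
      term : ∀ u → (λ i → basis u i * adjacency G u v) ∈⟨ generator γ ⟩
      term u with edge? G u v
      ... | yes e = ∈-scale 1ℤ (spans γ u (preds u e)) λ i → ℤ.*-comm (basis u i) 1ℤ
      ... | no  _ = ∈-null (null-zero λ i → ℤ.*-zeroʳ (basis u i))

    generates-∪ : ∀ {S} → Generates S → ∀ {v} → v ∉ S → (∀ u → Edge G u v → u ∈ S) →
      Generates (S ∪ ⁅ v ⁆)
    generates-∪ {S} γ {v} v∉S preds =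
      let g′ , g∈ , v∈ , tors = coprime-extension (d v) (order γ) (torsion γ) dv∈
                                  (coprime-sym (coprime γ v v∉S))
      in record
      { generator = g′
      ; order     = order γ ℕ.* d v
      ; spans     = λ w w∈ → spans′ g∈ v∈ (x∈p∪q⁻ S ⁅ v ⁆ w∈)
      ; torsion   = tors
      ; coprime   = λ w w∉ → coprime-* (coprime γ w (w∉ ∘ x∈p∪q⁺ ∘ inj₁))
          (d-coprime w v λ { refl → w∉ (x∈p∪q⁺ (inj₂ (x∈⁅x⁆ w))) })
      }
      where
      -- Column `v` of the simplex is zero in the cokernel, so d_v e_v is minus the sum over the
      -- in-neighbours.
      dv∈ : (λ i → + d v * basis v i) ∈⟨ generator γ ⟩
      dv∈ = ∈-linear 1ℤ (- 1ℤ) (∈-null (null-image (basis v))) (in-neighbours∈ γ preds) λ i → trans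
        (solve 2 (λ x y → x := con 1ℤ :* (x :+ y) :+ con (- 1ℤ) :* y) refl
          (+ d v * basis v i) (adjacency G i v))
        (cong (λ z → 1ℤ * z + - 1ℤ * adjacency G i v) (sym (simplex-basis G d v i)))

      spans′ : ∀ {g′ w} → generator γ ∈⟨ g′ ⟩ → basis v ∈⟨ g′ ⟩ → w ∈ S ⊎ w ∈ ⁅ v ⁆ → basis w ∈⟨ g′ ⟩
      spans′ g∈ v∈ (inj₁ w∈S) = ∈-trans (spans γ _ w∈S) g∈
      spans′ g∈ v∈ (inj₂ w∈v) with refl ← x∈⁅y⁆⇒x≡y v w∈v = v∈

    coprime-cyclic : Cyclic (AbelianGroup.group (coker (directedGraphicalSimplex d G)))
    -- Each round strictly enlarges `S`, so the process ends with every vertex spanned.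
    coprime-cyclic = go (⊃-wellFounded ⊥) generates-⊥
      where
      go : ∀ {S} → Acc _⊃_ S → Generates S →
        Cyclic (AbelianGroup.group (coker (directedGraphicalSimplex d G)))
      go {S} (acc rs) γ with any? (λ v → ¬? (v ∈? S))
      ... | no none = generator⇒cyclic (generator γ) (basis∈⇒all∈ λ v →
        spans γ v (decidable-stable (v ∈? S) (λ v∉S → none (v , v∉S))))
      ... | yes (_ , out) =
        let v , v∉S , preds = minimal-outside {G = G} acyclic S out
        in go (rs (p⊆p∪q ⁅ v ⁆ , v , x∈p∪q⁺ (inj₂ (x∈⁅x⁆ v)) , v∉S)) (generates-∪ γ v∉S preds)

-- Graphs with a path through all vertices.

module PathSimplex (G : SimpleDigraph (ℕ.suc n)) (acyclic : Acyclic G) (d : Vector ℕ (ℕ.suc n))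
  (p : Path G n) where

  open Coker (directedGraphicalSimplex d G)

  private
    π : Fin (ℕ.suc n) → Fin (ℕ.suc n)
    π = vertex p

    π-surjective : ∀ v → ∃[ k ] π k ≡ v
    π-surjective = injective⇒surjective (path-injective acyclic p)

    last : Vector ℤ (ℕ.suc n)
    last = basis (π (fromℕ n))

  directedPath-cyclic : (∀ i j → Edge G i j → ∃[ k ] (i ≡ π (inject₁ k) × j ≡ π (suc k))) →
    Cyclic (AbelianGroup.group (coker (directedGraphicalSimplex d G)))
  directedPath-cyclic only = generator⇒cyclic last (basis∈⇒all∈ λ v →
    let k , πk≡v = π-surjective v in subst (λ u → basis u ∈⟨ last ⟩) πk≡v (on-path k))
    where
    -- Every edge into π (suc k) is a step of the path, and vertices do not repeat, so its only
    -- in-neighbour is π (inject₁ k).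
    column : ∀ k i → adjacency G i (π (suc k)) ≡ basis (π (inject₁ k)) i
    column k i with i ≟ π (inject₁ k)
    ... | yes refl = adjacency-edge G (step p k)
    ... | no i≢ = adjacency-nonedge G λ e → i≢ (unique (only _ _ e))
      where
      unique : ∃[ l ] (i ≡ π (inject₁ l) × π (suc k) ≡ π (suc l)) → i ≡ π (inject₁ k)
      unique (l , i≡ , eq) with refl ← path-injective acyclic p eq = i≡

    on-path : ∀ k → basis (π k) ∈⟨ last ⟩
    on-path = >-weakInduction _ ∈-refl λ k ih →
      ∈-linear 1ℤ (- + d (π (suc k))) (∈-null (null-image (basis (π (suc k))))) ih λ i → trans
        (solve 3 (λ x c y → x := con 1ℤ :* (c :* y :+ x) :+ (:- c) :* y) refl
          (basis (π (inject₁ k)) i) (+ d (π (suc k))) (basis (π (suc k)) i))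
        (cong (λ z → 1ℤ * z + - + d (π (suc k)) * basis (π (suc k)) i)
          (sym (trans (simplex-basis G d (π (suc k)) i)
            (cong (_+_ (+ d (π (suc k)) * basis (π (suc k)) i)) (column k i)))))

  -- Back substitution: the given vectors are unitriangular along the path, so subtracting a
  -- multiple of the `k`-th one clears the entry of `x` at π k without disturbing the zeros beyond
  -- it.
  triangular⇒all∈ : ∀ {g} →
    (∀ k → ∃[ b ] b ∈⟨ g ⟩ × b (π k) ≡ 1ℤ × (∀ l → k <ᶠ l → b (π l) ≡ 0ℤ)) →
    ∀ x → x ∈⟨ g ⟩
  -- No index exceeds `fromℕ n`, so the vanishing condition is vacuous at the start.
  triangular⇒all∈ {g} tri x = upTo (fromℕ n) x λ l n<l →
    contradiction (ℕ.≤-trans (subst (ℕ._< toℕ l) (toℕ-fromℕ n) n<l) (ℕ.s≤s⁻¹ (toℕ<n l))) ℕ.1+n≰n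
    where
    residue : ∀ k → Vector ℤ (ℕ.suc n) → Vector ℤ (ℕ.suc n)
    residue k x i = x i + - (x (π k) * proj₁ (tri k) i)

    restore : ∀ k x → residue k x ∈⟨ g ⟩ → x ∈⟨ g ⟩
    restore k x r∈ = ∈-linear 1ℤ (x (π k)) r∈ (proj₁ (proj₂ (tri k))) λ i →
      solve 3 (λ x c b → x := con 1ℤ :* (x :+ (:- (c :* b))) :+ c :* b) refl
        (x i) (x (π k)) (proj₁ (tri k) i)

    residue-≥ : ∀ k x → (∀ l → k <ᶠ l → x (π l) ≡ 0ℤ) →
      ∀ l → toℕ k ≤ toℕ l → residue k x (π l) ≡ 0ℤ
    residue-≥ k x x≡0 l k≤l with ℕ.m≤n⇒m<n∨m≡n k≤l | tri k
    ... | inj₁ k<l | b , _ , _ , b≡0 = trans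
      (cong₂ (λ y z → y + - (x (π k) * z)) (x≡0 l k<l) (b≡0 l k<l))
      (solve 1 (λ c → con 0ℤ :+ (:- (c :* con 0ℤ)) := con 0ℤ) refl (x (π k)))
    ... | inj₂ k≡l | b , _ , b≡1 , _ with refl ← toℕ-injective k≡l = trans
      (cong (λ z → x (π k) + - (x (π k) * z)) b≡1)
      (solve 1 (λ c → c :+ (:- (c :* con 1ℤ)) := con 0ℤ) refl (x (π k)))

    -- `x` is quantified inside the induction because each step passes to its residue, supported on
    -- earlier positions.
    upTo : ∀ k x → (∀ l → k <ᶠ l → x (π l) ≡ 0ℤ) → x ∈⟨ g ⟩
    upTo = <-weakInduction _
      (λ x x≡0 → restore zero x (∈-null (null-zero λ v →
        let l , πl≡v = π-surjective v
        in subst (λ u → residue zero x u ≡ 0ℤ) πl≡v (residue-≥ zero x x≡0 l ℕ.z≤n))))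
      (λ k ih x x≡0 → restore (suc k) x (ih (residue (suc k) x) λ l k<l →
        residue-≥ (suc k) x x≡0 l (subst (ℕ._< toℕ l) (toℕ-inject₁ k) k<l)))

  constant-cyclic : ∀ {c} → (∀ i → d i ≡ c) →
    Cyclic (AbelianGroup.group (coker (directedGraphicalSimplex d G)))
  constant-cyclic {c} d≗c = generator⇒cyclic last (triangular⇒all∈ tri)
    where
    -- The simplex is cI + adjacency, so the adjacency matrix acts on the
    -- cokernel as -c.
    adjacency-∈ : ∀ {x} → x ∈⟨ last ⟩ → adjacency G · x ∈⟨ last ⟩
    adjacency-∈ {x} x∈ = ∈-linear 1ℤ (- + c) (∈-null (null-image x)) x∈ λ i → trans
      (solve 3 (λ c x y → y := con 1ℤ :* (c :* x :+ y) :+ (:- c) :* x) refl (+ c) (x i) ((adjacency G · x) i))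
      (cong (λ z → 1ℤ * z + - + c * x i) (sym (trans (simplex-· G d x i)
        (cong (λ e → + e * x i + (adjacency G · x) i) (d≗c i)))))

    -- A nonzero adjacency entry means a forward edge, so `b` has to vanish only when `k` precedes
    -- `l`.
    term≡0 : ∀ b k l → (k <ᶠ l → b (π l) ≡ 0ℤ) → adjacency G (π k) (π l) * b (π l) ≡ 0ℤ
    term≡0 b k l b≡0 with edge? G (π k) (π l)
    ... | no  _ = ℤ.*-zeroˡ (b (π l))
    ... | yes e = trans (ℤ.*-identityˡ (b (π l))) (b≡0 (path-edge-< acyclic p e))

    -- Downward induction: the vector at position `k` is the adjacency matrix applied n - k times to
    -- `last`.
    tri : ∀ k → ∃[ b ] b ∈⟨ last ⟩ × b (π k) ≡ 1ℤ × (∀ l → k <ᶠ l → b (π l) ≡ 0ℤ)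
    tri = >-weakInduction _
      (last , ∈-refl , diag-≡ _ (π (fromℕ n)) , λ l n<l → diag-≢ _ λ eq →
        ℕ.<-irrefl (cong toℕ (sym (path-injective acyclic p eq))) n<l)
      λ k (b , b∈ , b≡1 , b≡0) → adjacency G · b , adjacency-∈ b∈ ,
        -- Edges out of position `k` lead to `suc k` or further, and `b` vanishes beyond `suc k`;
        -- only the path step survives.
        (begin
          (adjacency G · b) (π (inject₁ k))
            ≡⟨ sum-single _ (π (suc k)) (λ v v≢ → off k b b≡0 v v≢ (π-surjective v)) ⟩
          adjacency G (π (inject₁ k)) (π (suc k)) * b (π (suc k))
            ≡⟨ cong₂ _*_ (adjacency-edge G (step p k)) b≡1 ⟩
          1ℤ ∎) ,
        -- From a row at `suc k` or later, edges lead strictly beyond `suc k`, where `b` is zero.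
        λ l k<l → sum-zero λ v → let l′ , πl′≡v = π-surjective v in
          subst (λ v → adjacency G (π l) v * b v ≡ 0ℤ) πl′≡v
            (term≡0 b l l′ λ l<l′ → b≡0 l′ (ℕ.≤-<-trans (subst (ℕ._< toℕ l) (toℕ-inject₁ k) k<l) l<l′))
      where
      open ≡-Reasoning
      off : ∀ k b → (∀ l → suc k <ᶠ l → b (π l) ≡ 0ℤ) → ∀ v → v ≢ π (suc k) →
        ∃[ l ] π l ≡ v → adjacency G (π (inject₁ k)) v * b v ≡ 0ℤ
      off k b b≡0 _ v≢ (l , refl) = term≡0 b (inject₁ k) l λ k<l →
        b≡0 l (ℕ.≤∧≢⇒< (subst (ℕ._< toℕ l) (toℕ-inject₁ k) k<l)
          λ eq → v≢ (cong π (sym (toℕ-injective eq))))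

theorem3p1 : (n : ℕ) → 1 ≤ n →
    (G : SimpleDigraph n) → Acyclic G →
    (d : Vector ℕ n) → (∀ i → 1 ≤ d i) →
    (PairwiseCoprime d
    ⊎ IsDirectedPath G
    ⊎ (Path G (n ∸ 1) × (∃[ m ] (1 ≤ m × (∀ i → d i ≡ m))))) →
    Cyclic (AbelianGroup.group (coker (directedGraphicalSimplex d G)))
theorem3p1 _ _ G acyclic d _ (inj₁ d-coprime) = Simplex.coprime-cyclic G acyclic d d-coprime
theorem3p1 (ℕ.suc n) _ G acyclic d _ (inj₂ (inj₁ (p , _ , only))) =
  PathSimplex.directedPath-cyclic G acyclic d p only
theorem3p1 (ℕ.suc n) _ G acyclic d _ (inj₂ (inj₂ (p , _ , _ , d≗c))) =
  PathSimplex.constant-cyclic G acyclic d p d≗c
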